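{- The non-negative integer solutions $(n,m,k)$ with $n \geq m$ of the Diophantine equation \[ L_n + L_m = J_k \] are exactly \[ (1,0,3),\ (2,0,4),\ (3,1,4),\ (4,3,5),\ (6,2,6),\ (15,1,12). \]
   Context: $(L_n)_{n\geq 0}$ is the Lucas sequence: $L_0=2$, $L_1=1$, $L_{n+2}=L_{n+1}+L_n$ for all $n\geq 0$. $(J_k)_{k\geq 0}$ is the Jacobsthal sequence: $J_0=0$, $J_1=1$, $J_{k+2}=J_{k+1}+2J_k$ for all $k\geq 0$. -}

module Defs where

open import Data.Nat using (ℕ; zero; suc; _+_; _*_)

L : ℕ → ℕ
L zero = 2
L (suc zero) = 1
L (suc (suc n)) = L (suc n) + L n

J : ℕ → ℕ
J zero = 0
J (suc zero) = 1
J (suc (suc k)) = J (suc k) + 2 * J k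

{-# OPTIONS --safe #-}
module Submission where

-- Write Lₙ and Jₖ through the powers of t in ℕ[t]/(t² = t + c), with c = 1 and c = 2.
-- For k < 13 the size of Lₙ leaves finitely many cases.  For k = 13 + j, the residue
-- classes of (n , m , j) modulo N are refined along N = 12, 24, 72, …, 184320, and at each
-- stage the classes are discarded on which Lₙ + Lₘ and J₁₃₊ⱼ are constant modulo a suitable M
-- with different values.  No class survives the last stage.  Since J₁₃₊ⱼ is 2-periodic
-- modulo 2¹³, a power of two dividing M tells these j apart from the solutions with k < 13,
-- which no modulus coprime to 2 could exclude.

open import Defs
open import Algebra.Bundles using (Monoid)
open import Algebra.Properties.Monoid.Mult using (×-homo-+; ×-assocˡ)
import Algebra.Definitions.RawMonoid as RawMonoidPowers
open import Data.List using (List; []; _∷_; map; upTo; cartesianProduct; concatMap; filter)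
open import Data.List.Membership.Propositional using (_∈_; lose)
open import Data.List.Membership.Propositional.Properties
  using (∈-map⁺; ∈-upTo⁺; ∈-cartesianProduct⁺; ∈-concatMap⁺; ∈-filter⁺)
open import Data.List.Relation.Unary.Any using (here)
open import Data.List.Relation.Unary.Any.Properties using (¬Any[])
open import Data.Nat using (ℕ; zero; suc; _+_; _*_; _≤_; _<_; _≤?_; _<?_; _≟_; _%_; _/_; NonZero)
open import Data.Nat.DivMod using (%-distribˡ-+; %-distribˡ-*; m≡m%n+[m/n]*n; m%n<n)
open import Data.Nat.Properties
  using (allUpTo?; m≤n⇒∃[o]m+o≡n; m≤n⇒m≤n+o; m≤m+n; m≤n+m; ≤-trans; ≮⇒≥; <⇒≱)
open import Data.Nat.Tactic.RingSolver using (solve-∀)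
open import Data.Product using (∃; _×_; _,_)
open import Data.Product.Properties using (≡-dec)
open import Data.Sum using (_⊎_; inj₁; inj₂)
open import Function.Bundles using (_⇔_; mk⇔)
open import Level using (0ℓ)
open import Relation.Binary.PropositionalEquality
  using (_≡_; refl; sym; trans; cong; cong₂; subst; isEquivalence; module ≡-Reasoning)
open import Relation.Nullary using (¬_; Dec; yes; no; ¬?; contradiction)
open import Relation.Nullary.Decidable using (_×-dec_; _⊎-dec_; _→-dec_; from-yes)

-- Congruences modulo M for numbers and for a + b t

infix 4 _≡_[mod_] _≈_[mod_]

_≡_[mod_] : ℕ → ℕ → (M : ℕ) .{{_ : NonZero M}} → Set
a ≡ b [mod M ] = a % M ≡ b % M

+-cong-mod : ∀ M .{{_ : NonZero M}} {a b c d} →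
  a ≡ b [mod M ] → c ≡ d [mod M ] → a + c ≡ b + d [mod M ]
+-cong-mod M {a} {b} {c} {d} p q =
  trans (%-distribˡ-+ a c M) (trans (cong₂ (λ x y → (x + y) % M) p q) (sym (%-distribˡ-+ b d M)))

*-cong-mod : ∀ M .{{_ : NonZero M}} {a b c d} →
  a ≡ b [mod M ] → c ≡ d [mod M ] → a * c ≡ b * d [mod M ]
*-cong-mod M {a} {b} {c} {d} p q =
  trans (%-distribˡ-* a c M) (trans (cong₂ (λ x y → (x * y) % M) p q) (sym (%-distribˡ-* b d M)))

-- ⟨ a , b ⟩ stands for a + b t.
data Quad : Set where
  ⟨_,_⟩ : ℕ → ℕ → Quad

t-coefficient : Quad → ℕ
t-coefficient ⟨ a , b ⟩ = b

_≈_[mod_] : Quad → Quad → (M : ℕ) .{{_ : NonZero M}} → Set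
⟨ a , b ⟩ ≈ ⟨ a′ , b′ ⟩ [mod M ] = a ≡ a′ [mod M ] × b ≡ b′ [mod M ]

≈-refl : ∀ x M .{{_ : NonZero M}} → x ≈ x [mod M ]
≈-refl ⟨ a , b ⟩ M = refl , refl

≈-trans : ∀ x y z M .{{_ : NonZero M}} → x ≈ y [mod M ] → y ≈ z [mod M ] → x ≈ z [mod M ]
≈-trans ⟨ _ , _ ⟩ ⟨ _ , _ ⟩ ⟨ _ , _ ⟩ M (p , q) (p′ , q′) = trans p p′ , trans q q′

≈-dec : ∀ x y M .{{_ : NonZero M}} → Dec (x ≈ y [mod M ])
≈-dec ⟨ a , b ⟩ ⟨ a′ , b′ ⟩ M = (a % M ≟ a′ % M) ×-dec (b % M ≟ b′ % M)

one t : Quad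
one = ⟨ 1 , 0 ⟩
t = ⟨ 0 , 1 ⟩

-- Powers in ℕ[t]/(t² = t + c)

module Quadratic (c : ℕ) where

  infixr 7 _⊗_

  _⊗_ : Quad → Quad → Quad
  ⟨ a , b ⟩ ⊗ ⟨ x , y ⟩ = ⟨ a * x + c * (b * y) , a * y + b * x + b * y ⟩

  ⊗-assoc : ∀ x y z → (x ⊗ y) ⊗ z ≡ x ⊗ (y ⊗ z)
  ⊗-assoc ⟨ a , b ⟩ ⟨ x , y ⟩ ⟨ u , v ⟩ = cong₂ ⟨_,_⟩ (first c a b x y u v) (second c a b x y u v)
    where
    first : ∀ c a b x y u v →
      (a * x + c * (b * y)) * u + c * ((a * y + b * x + b * y) * v)
        ≡ a * (x * u + c * (y * v)) + c * (b * (x * v + y * u + y * v))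
    first = solve-∀
    second : ∀ c a b x y u v →
      (a * x + c * (b * y)) * v + (a * y + b * x + b * y) * u + (a * y + b * x + b * y) * v
        ≡ a * (x * v + y * u + y * v) + b * (x * u + c * (y * v)) + b * (x * v + y * u + y * v)
    second = solve-∀

  ⊗-identityˡ : ∀ x → one ⊗ x ≡ x
  ⊗-identityˡ ⟨ x , y ⟩ = cong₂ ⟨_,_⟩ (first c x) (second x y)
    where
    first : ∀ c x → 1 * x + c * 0 ≡ x
    first = solve-∀
    second : ∀ x y → 1 * y + 0 * x + 0 * y ≡ y
    second = solve-∀

  ⊗-identityʳ : ∀ x → x ⊗ one ≡ x
  ⊗-identityʳ ⟨ x , y ⟩ = cong₂ ⟨_,_⟩ (first c x y) (second x y)
    where
    first : ∀ c x y → x * 1 + c * (y * 0) ≡ x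
    first = solve-∀
    second : ∀ x y → x * 0 + y * 1 + y * 0 ≡ y
    second = solve-∀

  ⊗-monoid : Monoid 0ℓ 0ℓ
  ⊗-monoid = record
    { Carrier = Quad ; _≈_ = _≡_ ; _∙_ = _⊗_ ; ε = one
    ; isMonoid = record
      { isSemigroup = record
        { isMagma = record { isEquivalence = isEquivalence ; ∙-cong = cong₂ _⊗_ }
        ; assoc = ⊗-assoc }
      ; identity = ⊗-identityˡ , ⊗-identityʳ } }

  -- n ⋆ x is the power xⁿ.
  open RawMonoidPowers (Monoid.rawMonoid ⊗-monoid) public using () renaming (_×_ to _⋆_)

  ⊗-congˡ-mod : ∀ M .{{_ : NonZero M}} x y z → x ≈ y [mod M ] → x ⊗ z ≈ y ⊗ z [mod M ]
  ⊗-congˡ-mod M ⟨ a , b ⟩ ⟨ a′ , b′ ⟩ ⟨ x , y ⟩ (p , q) =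
    +-cong-mod M {a * x} {a′ * x} (p *ʳ x)
      (*-cong-mod M {c} {c} {b * y} {b′ * y} refl (q *ʳ y)) ,
    +-cong-mod M {a * y + b * x} {a′ * y + b′ * x}
      (+-cong-mod M {a * y} {a′ * y} (p *ʳ y) (q *ʳ x)) (q *ʳ y)
    where
    _*ʳ_ : ∀ {i j} → i ≡ j [mod M ] → ∀ l → i * l ≡ j * l [mod M ]
    _*ʳ_ {i} {j} r l = *-cong-mod M {i} {j} {l} {l} r refl

  -- Induction on x, absorbing one factor ψ into u at a time. The hypothesis is not ψ ≡ 1: for c = 2
  -- and even M, t is no unit, since t (t - 1) = 2, and no positive power of t is 1 modulo M.
  fixed-by-powers : ∀ M .{{_ : NonZero M}} u ψ → u ⊗ ψ ≈ u [mod M ] →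
    ∀ x → u ⊗ (x ⋆ ψ) ≈ u [mod M ]
  fixed-by-powers M u ψ fixed zero = subst (_≈ u [mod M ]) (sym (⊗-identityʳ u)) (≈-refl u M)
  fixed-by-powers M u ψ fixed (suc x) = subst (_≈ u [mod M ]) (⊗-assoc u ψ (x ⋆ ψ))
    (≈-trans _ (u ⊗ (x ⋆ ψ)) _ M
      (⊗-congˡ-mod M (u ⊗ ψ) u (x ⋆ ψ) fixed) (fixed-by-powers M u ψ fixed x))

  -- Equality is exact, not modulo some M, so that the same class can be tested against a new
  -- modulus at every stage.
  Coset : Quad → Quad → Quad → Set
  Coset ψ z u = ∃ λ x → z ≡ u ⊗ (x ⋆ ψ)

  subcosets : Quad → ℕ → Quad → List Quad
  subcosets ψ q u = map (λ i → u ⊗ (i ⋆ ψ)) (upTo q)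

  -- Division of the exponent with remainder: for i = x % q, u ψˣ is u ψⁱ times the power x / q of
  -- `q ⋆ ψ`.
  refine : ∀ ψ q .{{_ : NonZero q}} {z u} → Coset ψ z u →
    ∃ λ u′ → u′ ∈ subcosets ψ q u × Coset (q ⋆ ψ) z u′
  refine ψ q {z} {u} (x , z≡) =
    u ⊗ (i ⋆ ψ) , ∈-map⁺ _ (∈-upTo⁺ (m%n<n x q)) , x / q , (begin
      z                                       ≡⟨ z≡ ⟩
      u ⊗ (x ⋆ ψ)                             ≡⟨ cong (λ y → u ⊗ (y ⋆ ψ)) (m≡m%n+[m/n]*n x q) ⟩
      u ⊗ ((i + x / q * q) ⋆ ψ)               ≡⟨ cong (u ⊗_) (×-homo-+ ⊗-monoid ψ i (x / q * q)) ⟩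
      u ⊗ ((i ⋆ ψ) ⊗ ((x / q * q) ⋆ ψ))       ≡⟨ ⊗-assoc u _ _ ⟨
      (u ⊗ (i ⋆ ψ)) ⊗ ((x / q * q) ⋆ ψ)       ≡⟨ cong ((u ⊗ (i ⋆ ψ)) ⊗_) (×-assocˡ ⊗-monoid ψ (x / q) q) ⟨
      (u ⊗ (i ⋆ ψ)) ⊗ ((x / q) ⋆ (q ⋆ ψ))     ∎)
    where
    open ≡-Reasoning
    i = x % q

-- Lucas and Jacobsthal numbers from powers of t

module Φ = Quadratic 1
module Θ = Quadratic 2

-- The trace of a + b t for t² = t + 1.
trace : Quad → ℕ
trace ⟨ a , b ⟩ = 2 * a + b

-- The trace is additive and t² z = t z + z, so the traces of the powers of t obey the Lucas
-- recurrence.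
L-trace : ∀ n → L n ≡ trace (n Φ.⋆ t)
L-trace zero = refl
L-trace (suc zero) = refl
L-trace (suc (suc n)) =
  trans (cong₂ _+_ (L-trace (suc n)) (L-trace n)) (recurrence (n Φ.⋆ t))
  where
  recurrence : ∀ z → trace (t Φ.⊗ z) + trace z ≡ trace (t Φ.⊗ t Φ.⊗ z)
  recurrence ⟨ x , y ⟩ = identity x y
    where
    identity : ∀ x y → (2 * (0 * x + 1 * (1 * y)) + (0 * y + 1 * x + 1 * y)) + (2 * x + y)
      ≡ 2 * (0 * (0 * x + 1 * (1 * y)) + 1 * (1 * (0 * y + 1 * x + 1 * y)))
        + (0 * (0 * y + 1 * x + 1 * y) + 1 * (0 * x + 1 * (1 * y)) + 1 * (0 * y + 1 * x + 1 * y))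
    identity = solve-∀

-- Here t² z = t z + 2 z, and taking the t-coefficient is additive.
J-coefficient : ∀ k → J k ≡ t-coefficient (k Θ.⋆ t)
J-coefficient zero = refl
J-coefficient (suc zero) = refl
J-coefficient (suc (suc k)) =
  trans (cong₂ (λ x y → x + 2 * y) (J-coefficient (suc k)) (J-coefficient k)) (recurrence (k Θ.⋆ t))
  where
  recurrence : ∀ z → t-coefficient (t Θ.⊗ z) + 2 * t-coefficient z ≡ t-coefficient (t Θ.⊗ t Θ.⊗ z)
  recurrence ⟨ x , y ⟩ = identity x y
    where
    identity : ∀ x y → (0 * y + 1 * x + 1 * y) + 2 * y
      ≡ 0 * (0 * y + 1 * x + 1 * y) + 1 * (0 * x + 2 * (1 * y)) + 1 * (0 * y + 1 * x + 1 * y)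
    identity = solve-∀

-- The sieve on residue classes

-- Representatives (tⁿ , tᵐ , tᵏ) of a residue class of triples (n , m , k).
Class : Set
Class = Quad × Quad × Quad

Solution : Class → Set
Solution (x , y , z) = trace x + trace y ≡ t-coefficient z

-- In the sieve, φ and θ are the power tᴺ in `Φ` and in `Θ`, where N is the current modulus of the
-- exponents.
InClass : Quad → Quad → Class → Class → Set
InClass φ θ (x , y , z) (u , v , w) = Φ.Coset φ x u × Φ.Coset φ y v × Θ.Coset θ z w

subclasses : Quad → Quad → ℕ → Class → List Class
subclasses φ θ q (u , v , w) =
  cartesianProduct (Φ.subcosets φ q u) (cartesianProduct (Φ.subcosets φ q v) (Θ.subcosets θ q w))

module _ (φ θ : Quad) (M : ℕ) .{{_ : NonZero M}} where

  Constant : Class → Set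
  Constant (u , v , w) = u Φ.⊗ φ ≈ u [mod M ] × v Φ.⊗ φ ≈ v [mod M ] × w Θ.⊗ θ ≈ w [mod M ]

  constant? : ∀ s → Dec (Constant s)
  constant? (u , v , w) =
    ≈-dec (u Φ.⊗ φ) u M ×-dec ≈-dec (v Φ.⊗ φ) v M ×-dec ≈-dec (w Θ.⊗ θ) w M

  -- Classes that fail the constancy test are kept, so the sieve is sound for every choice of q and
  -- M and no period has to be proved in advance.
  Survives : Class → Set
  Survives (u , v , w) = trace u + trace v ≡ t-coefficient w [mod M ] ⊎ ¬ Constant (u , v , w)

  survives? : ∀ s → Dec (Survives s)
  survives? (u , v , w) = ((trace u + trace v) % M ≟ t-coefficient w % M) ⊎-dec ¬? (constant? (u , v , w))

  trace-cong-mod : ∀ x y → x ≈ y [mod M ] → trace x ≡ trace y [mod M ]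
  trace-cong-mod ⟨ a , b ⟩ ⟨ a′ , b′ ⟩ (p , q) =
    +-cong-mod M {2 * a} {2 * a′} (*-cong-mod M {2} {2} {a} {a′} refl p) q

  t-coefficient-cong-mod : ∀ x y → x ≈ y [mod M ] → t-coefficient x ≡ t-coefficient y [mod M ]
  t-coefficient-cong-mod ⟨ _ , _ ⟩ ⟨ _ , _ ⟩ (_ , q) = q

  -- On a constant class both sides of the equation may be evaluated modulo M at the representative.
  solution-survives : ∀ {s s′} → Solution s → InClass φ θ s s′ → Survives s′
  solution-survives {s′ = u , v , w} sol ((i , refl) , (j , refl) , (l , refl))
    with constant? (u , v , w)
  ... | no ¬const = inj₂ ¬const
  ... | yes (cu , cv , cw) = inj₁ (begin
    (trace u + trace v) % M
      ≡⟨ +-cong-mod M {trace (u Φ.⊗ (i Φ.⋆ φ))} {trace u}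
           (trace-cong-mod _ u (Φ.fixed-by-powers M u φ cu i))
           (trace-cong-mod _ v (Φ.fixed-by-powers M v φ cv j)) ⟨
    (trace (u Φ.⊗ (i Φ.⋆ φ)) + trace (v Φ.⊗ (j Φ.⋆ φ))) % M
      ≡⟨ cong (_% M) sol ⟩
    t-coefficient (w Θ.⊗ (l Θ.⋆ θ)) % M
      ≡⟨ t-coefficient-cong-mod _ w (Θ.fixed-by-powers M w θ cw l) ⟩
    t-coefficient w % M ∎)
    where open ≡-Reasoning

record Stage : Set where
  constructor stage
  field
    q M : ℕ
    .{{q≢0}} : NonZero q
    .{{M≢0}} : NonZero M

sieve : List Stage → Quad → Quad → List Class → List Class
sieve [] φ θ classes = classes
sieve (stage q M ∷ stages) φ θ classes =
  sieve stages φ′ θ′ (filter (survives? φ′ θ′ M) (concatMap (subclasses φ θ q) classes))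
  where
  φ′ = q Φ.⋆ φ
  θ′ = q Θ.⋆ θ

-- The solution `s` stays fixed; each stage only replaces the class around it by the subclass that
-- contains it.
sieve-keeps-solutions : ∀ stages φ θ classes {s s′} → Solution s → InClass φ θ s s′ → s′ ∈ classes →
  ∃ λ s″ → s″ ∈ sieve stages φ θ classes
sieve-keeps-solutions [] φ θ classes sol s∈s′ s′∈ = _ , s′∈
sieve-keeps-solutions (stage q M ∷ stages) φ θ classes sol (x∈ , y∈ , z∈) s′∈ =
  let u , u∈ , x∈′ = Φ.refine φ q x∈
      v , v∈ , y∈′ = Φ.refine φ q y∈
      w , w∈ , z∈′ = Θ.refine θ q z∈
      φ′ = q Φ.⋆ φ
      θ′ = q Θ.⋆ θ
      s∈ = x∈′ , y∈′ , z∈′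
  in sieve-keeps-solutions stages φ′ θ′ _ sol s∈
       (∈-filter⁺ (survives? φ′ θ′ M)
         (∈-concatMap⁺ (subclasses φ θ q)
           (lose s′∈ (∈-cartesianProduct⁺ u∈ (∈-cartesianProduct⁺ v∈ w∈))))
         (solution-survives φ′ θ′ M sol s∈))

solution-by-powers : ∀ n m k → L n + L m ≡ J k → Solution (n Φ.⋆ t , m Φ.⋆ t , k Θ.⋆ t)
solution-by-powers n m k eq =
  trans (sym (cong₂ _+_ (L-trace n) (L-trace m))) (trans eq (J-coefficient k))

no-survivor⇒no-solution : ∀ K stages → sieve stages t t ((one , one , K Θ.⋆ t) ∷ []) ≡ [] →
  ∀ n m k → K ≤ k → ¬ (L n + L m ≡ J k)
no-survivor⇒no-solution K stages none n m k K≤k eq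
  with j , refl ← m≤n⇒∃[o]m+o≡n K≤k =
  -- The sieve starts at N = 1: the single class of (1, 1, tᴷ) contains every triple with k ≥ K,
  -- with exponents n, m and j = k - K.
  let s , s∈ = sieve-keeps-solutions stages t t _ (solution-by-powers n m k eq)
        ((n , sym (Φ.⊗-identityˡ _)) , (m , sym (Φ.⊗-identityˡ _)) , (j , ×-homo-+ Θ.⊗-monoid t K j))
        (here refl)
  in ¬Any[] (subst (s ∈_) none s∈)

-- The moduli and the case k ≥ 13

-- The moduli are chosen among those for which Lₙ and J₁₃₊ⱼ are periodic with period N.
stages : List Stage
stages =
  stage 12 8 ∷
  stage 2 (3 * 16) ∷
  stage 3 (17 * 19) ∷
  stage 5 (11 * 31 * 41 * 61) ∷
  stage 4 (7 * 64 * 241) ∷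
  stage 4 (256 * 641 * 769) ∷
  stage 2 (512 * 23041) ∷
  stage 2 (1024 * 7681) ∷
  stage 4 (4096 * 12289 * 40961) ∷
  stage 2 (8192 * 61441 * 184321) ∷
  []

-- Proved by evaluation; filtering between refinements avoids listing all 184320³ classes. As J₁₄ -
-- J₁₂ = 2¹², the class with n ≡ 15, m ≡ 1, k ≡ 12 modulo N passes every stage before the last,
-- whose M is divisible by 2¹³.
nothing-survives : sieve stages t t ((one , one , 13 Θ.⋆ t) ∷ []) ≡ []
nothing-survives = refl

no-solution-beyond-12 : ∀ n m k → 13 ≤ k → ¬ (L n + L m ≡ J k)
no-solution-beyond-12 = no-survivor⇒no-solution 13 stages nothing-survives

-- The case k < 13 by enumeration

Listed : ℕ → ℕ → ℕ → Set
Listed n m k =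
  (n , m , k) ≡ (1 , 0 , 3) ⊎ (n , m , k) ≡ (2 , 0 , 4) ⊎ (n , m , k) ≡ (3 , 1 , 4)
    ⊎ (n , m , k) ≡ (4 , 3 , 5) ⊎ (n , m , k) ≡ (6 , 2 , 6) ⊎ (n , m , k) ≡ (15 , 1 , 12)

listed? : ∀ n m k → Dec (Listed n m k)
listed? n m k =
  is (1 , 0 , 3) ⊎-dec is (2 , 0 , 4) ⊎-dec is (3 , 1 , 4)
    ⊎-dec is (4 , 3 , 5) ⊎-dec is (6 , 2 , 6) ⊎-dec is (15 , 1 , 12)
  where
  is : (s : ℕ × ℕ × ℕ) → Dec ((n , m , k) ≡ s)
  is = ≡-dec _≟_ (≡-dec _≟_ _≟_) (n , m , k)

L-large : ∀ n → 16 ≤ n → 1365 < L n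
L-large n 16≤n = let i , 16+i≡n = m≤n⇒∃[o]m+o≡n 16≤n in
  subst (λ n → 1365 < L n) 16+i≡n (shifted i)
  where
  shifted : ∀ i → 1365 < L (16 + i)
  -- The bound 1365 is J₁₂, and 2207 and 3571 are L₁₆ and L₁₇; the index 16 is least possible, as
  -- L₁₅ = 1364.
  shifted zero = from-yes (1365 <? 2207)
  shifted (suc zero) = from-yes (1365 <? 3571)
  shifted (suc (suc i)) = m≤n⇒m≤n+o (L (16 + i)) (shifted (suc i))

J-small : ∀ {k} → k < 13 → J k ≤ 1365
J-small = from-yes (allUpTo? (λ k → J k ≤? 1365) 13)

L-summand-small : ∀ n {k} → L n ≤ J k → k < 13 → n < 16
L-summand-small n L≤J k<13 with n <? 16
... | yes n<16 = n<16
... | no n≮16 = contradiction (≤-trans L≤J (J-small k<13)) (<⇒≱ (L-large n (≮⇒≥ n≮16)))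

small-solutions : ∀ {n} → n < 16 → ∀ {m} → m < 16 → ∀ {k} → k < 13 →
  m ≤ n → L n + L m ≡ J k → Listed n m k
small-solutions = from-yes
  (allUpTo? (λ n → allUpTo? (λ m → allUpTo? (λ k →
    (m ≤? n) →-dec (L n + L m ≟ J k) →-dec listed? n m k) 13) 16) 16)

theorem1p2 : (n m k : ℕ) → m ≤ n →
    (L n + L m ≡ J k) ⇔
    ((n , m , k) ≡ (1 , 0 , 3) ⊎ (n , m , k) ≡ (2 , 0 , 4) ⊎ (n , m , k) ≡ (3 , 1 , 4)
    ⊎ (n , m , k) ≡ (4 , 3 , 5) ⊎ (n , m , k) ≡ (6 , 2 , 6) ⊎ (n , m , k) ≡ (15 , 1 , 12))
theorem1p2 n m k m≤n = mk⇔ listed solves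
  where
  listed : L n + L m ≡ J k → Listed n m k
  listed eq with k <? 13
  ... | yes k<13 = small-solutions
          (L-summand-small n (subst (L n ≤_) eq (m≤m+n (L n) (L m))) k<13)
          (L-summand-small m (subst (L m ≤_) eq (m≤n+m (L m) (L n))) k<13)
          k<13 m≤n eq
  ... | no k≮13 = contradiction eq (no-solution-beyond-12 n m k (≮⇒≥ k≮13))

  solves : Listed n m k → L n + L m ≡ J k
  solves (inj₁ refl) = refl
  solves (inj₂ (inj₁ refl)) = refl
  solves (inj₂ (inj₂ (inj₁ refl))) = refl
  solves (inj₂ (inj₂ (inj₂ (inj₁ refl)))) = refl
  solves (inj₂ (inj₂ (inj₂ (inj₂ (inj₁ refl))))) = refl
  solves (inj₂ (inj₂ (inj₂ (inj₂ (inj₂ refl))))) = refl
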